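{- Let $G=(V,E)$ be a series-parallel graph with source $s$ and sink $t$, and let $\ell$ be the assignment of erasers with $\ell(s) = 0$, $\ell(t) = 1$ and $\ell(v) = 2$ for every other vertex $v\in V\setminus\{s,t\}$. Then $G$ is $\ell$-paintable.
   Context: Graphs are finite, simple and undirected. The (classical) on-line list colouring game is played by Mr. Paint and Mrs. Correct on a graph $G$ known to both, with an assignment of erasers $\ell: V(G)\to\{0,1,2,\dots\}$; initially all vertices are uncoloured. In each round Mr. Paint takes a new colour (never used before and never to be used again) and colours with it a nonempty set $V_P$ of currently uncoloured vertices (adjacent vertices are allowed). Mrs. Correct then chooses a subset $V_C\subseteq V_P$ and removes the colour from the vertices in $V_C$; this consumes one eraser at each vertex of $V_C$, so each of them must have at least one eraser remaining. The set $V_P\setminus V_C$, whose vertices stay coloured permanently, must be independent in $G$. If Mrs. Correct cannot make such a choice because she has run out of erasers at some vertex, Mr. Paint wins; if all of $G$ becomes (properly) coloured, Mrs. Correct wins. The graph $G$ is $\ell$-paintable if Mrs. Correct has a winning strategy. Series-parallel graphs are graphs with two distinguished distinct vertices $s$ (source) and $t$ (sink), defined inductively: (1) a single edge $(s,t)$ is a series-parallel graph; (2) any graph obtained from two (vertex-disjoint) series-parallel graphs $G_1,G_2$ with sources $s_1,s_2$ and sinks $t_1,t_2$ by a series composition (identify $t_1$ with $s_2$; the new source is $s_1$ and the new sink is $t_2$) or by a parallel composition (identify $s_1$ with $s_2$ to form the new source and $t_1$ with $t_2$ to form the new sink) is a series-parallel graph; since graphs are simple, parallel edges that arise are merged into one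 edge. -}

module Defs where

open import Data.Bool using (if_then_else_)
open import Data.Fin using (Fin)
open import Data.Fin.Subset using (Subset; _∈_; _⊆_; _─_; ⊤; Empty; Nonempty)
open import Data.Fin.Subset.Properties using (_∈?_)
open import Data.Nat using (ℕ; pred; _<_)
open import Data.Product using (_×_; ∃-syntax; ∃₂)
open import Data.Sum using (_⊎_; inj₁; inj₂)
open import Data.Sum.Relation.Binary.Pointwise using (Pointwise)
open import Function.Bundles using (_⇔_)
open import Function.Definitions using (Surjective)
open import Level using (0ℓ)
open import Relation.Binary using (Rel; Symmetric; Irreflexive; Decidable)
open import Relation.Binary.Construct.Closure.Equivalence using (EqClosure)
open import Relation.Binary.PropositionalEquality using (_≡_)
open import Relation.Nullary using (¬_; does)

record Graph (n : ℕ) : Set₁ where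
  field
    Adj    : Rel (Fin n) 0ℓ
    sym    : Symmetric Adj
    irrefl : Irreflexive _≡_ Adj
    adj?   : Decidable Adj

open Graph public using (Adj)

Independent : ∀ {n} → Graph n → Subset n → Set
Independent G S = ∀ {u v} → u ∈ S → v ∈ S → ¬ Adj G u v

Erasers : ℕ → Set
Erasers n = Fin n → ℕ

useErasers : ∀ {n} → Subset n → Erasers n → Erasers n
useErasers C ℓ v = if does (v ∈? C) then pred (ℓ v) else ℓ v

-- A winning strategy for Mrs. Correct from the position with set U of
-- uncoloured vertices and remaining erasers ℓ. Past colours are never reused,
-- so they do not affect the position. Every round colours a vertex for good or
-- uses up an eraser, so all plays are finite and a strategy is a well-founded
-- tree.
data CorrectWins {n} (G : Graph n) (U : Subset n) (ℓ : Erasers n) : Set where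
  coloured : Empty U → CorrectWins G U ℓ
  respond  : (∀ P → Nonempty P → P ⊆ U →
               ∃[ C ] (C ⊆ P
                     × (∀ {v} → v ∈ C → 0 < ℓ v)
                     × Independent G (P ─ C)
                     × CorrectWins G (U ─ (P ─ C)) (useErasers C ℓ)))
           → CorrectWins G U ℓ

Paintable : ∀ {n} → Graph n → Erasers n → Set
Paintable G ℓ = CorrectWins G ⊤ ℓ

-- G is, via q, the simple graph obtained from the disjoint union of G₁ and G₂
-- by identifying the vertices related by _~_; parallel edges merge because
-- adjacency is a relation.
record IsGluing {n₁ n₂ n} (G₁ : Graph n₁) (G₂ : Graph n₂)
                (_~_ : Rel (Fin n₁ ⊎ Fin n₂) 0ℓ)
                (G : Graph n) (q : Fin n₁ ⊎ Fin n₂ → Fin n) : Set where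
  field
    surjective : Surjective _≡_ _≡_ q
    kernel     : ∀ {x y} → q x ≡ q y ⇔ EqClosure _~_ x y
    adjacency  : ∀ {u v} → Adj G u v ⇔
                   ∃₂ λ x y → q x ≡ u × q y ≡ v × Pointwise (Adj G₁) (Adj G₂) x y

data SeriesId {n₁ n₂} (t₁ : Fin n₁) (s₂ : Fin n₂) : Rel (Fin n₁ ⊎ Fin n₂) 0ℓ where
  t₁~s₂ : SeriesId t₁ s₂ (inj₁ t₁) (inj₂ s₂)

data ParallelId {n₁ n₂} (s₁ t₁ : Fin n₁) (s₂ t₂ : Fin n₂) :
                Rel (Fin n₁ ⊎ Fin n₂) 0ℓ where
  s₁~s₂ : ParallelId s₁ t₁ s₂ t₂ (inj₁ s₁) (inj₂ s₂)
  t₁~t₂ : ParallelId s₁ t₁ s₂ t₂ (inj₁ t₁) (inj₂ t₂)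

-- SeriesParallel G s t: G is series-parallel with source s and sink t.
-- Since the compositions are specified by IsGluing, the notion is invariant
-- under isomorphism; s and t are distinct in every case.
data SeriesParallel : ∀ {n} → Graph n → Fin n → Fin n → Set₁ where
  edge : ∀ {n} {G : Graph n} {s t} →
         Adj G s t → (∀ v → v ≡ s ⊎ v ≡ t) →
         SeriesParallel G s t
  series : ∀ {n₁ n₂ n} {G₁ : Graph n₁} {G₂ : Graph n₂} {G : Graph n}
             {s₁ t₁ s₂ t₂ q} →
           SeriesParallel G₁ s₁ t₁ → SeriesParallel G₂ s₂ t₂ →
           IsGluing G₁ G₂ (SeriesId t₁ s₂) G q →
           SeriesParallel G (q (inj₁ s₁)) (q (inj₂ t₂))
  parallel : ∀ {n₁ n₂ n} {G₁ : Graph n₁} {G₂ : Graph n₂} {G : Graph n}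
               {s₁ t₁ s₂ t₂ q} →
             SeriesParallel G₁ s₁ t₁ → SeriesParallel G₂ s₂ t₂ →
             IsGluing G₁ G₂ (ParallelId s₁ t₁ s₂ t₂) G q →
             SeriesParallel G (q (inj₁ s₁)) (q (inj₁ t₁))

{-# OPTIONS --safe #-}
-- A series-parallel graph is, up to the edge s t, built from its two terminals
-- by adding vertices with at most two earlier neighbours (its "parents"): in a
-- series composition the middle vertex comes first with parents s and t, then
-- both parts are built on their own terminals. Hence every vertex has at least
-- as many erasers as parents. Mrs. Correct keeps a presented vertex exactly
-- when none of its parents is kept: then each erased vertex loses an uncoloured
-- parent together with the eraser, so erasers never run short.
module Submission where

open import Defs
open import Data.Bool using (if_then_else_; false)
open import Data.Fin using (Fin)
open import Data.Fin.Properties using (_≟_)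
open import Data.Fin.Subset using (Subset; _∈_; _∉_; _⊆_; _⊂_; _─_; ⊤; Nonempty; inside; outside)
open import Data.Fin.Subset.Induction using (⊂-wellFounded)
open import Data.Fin.Subset.Properties using (_∈?_; p─q⊆p; x∈p∧x∉q⇒x∈p─q)
open import Data.List using (List; []; _∷_; map; length; filter)
open import Data.List.Membership.Propositional using () renaming (_∈_ to _∈ˡ_; _∉_ to _∉ˡ_)
open import Data.List.Membership.Propositional.Properties using (∈-map⁺; ∈-map⁻)
open import Data.List.Properties using (length-map; length-filter)
open import Data.List.Relation.Unary.All as All using (All; []; _∷_)
open import Data.List.Relation.Unary.Any as Any using (Any; here; there)
open import Data.Nat using (ℕ; suc; pred; _≤_; _<_; z≤n; s≤s)
open import Data.Nat.Induction using (<-wellFounded)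
open import Data.Nat.Properties using (≤-refl; ≤-reflexive; ≤-trans; ≤-<-trans; <⇒≤pred; m≤n⇒m≤1+n; n≮0)
open import Data.Product using (_×_; _,_; proj₁; proj₂; ∃-syntax)
open import Data.Sum using (_⊎_; inj₁; inj₂; [_,_])
open import Data.Sum.Relation.Binary.Pointwise using (Pointwise; inj₁; inj₂)
open import Data.Vec using (tabulate; here; there) renaming (_∷_ to _∷ᵛ_)
open import Data.Vec.Properties using (lookup∘tabulate; lookup⇒[]=; []=⇒lookup)
open import Function using (_∘_; id; const)
open import Function.Bundles using (Equivalence)
open import Induction.WellFounded using (WellFounded; Acc; acc; module Subrelation)
open import Level using (0ℓ)
open import Relation.Binary using (Rel)
open import Relation.Binary.Construct.Closure.Equivalence as Eq using ()
open import Relation.Binary.Construct.Closure.Symmetric as Sym using (SymClosure; fwd; bwd)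
import Relation.Binary.Construct.On as On
open import Relation.Binary.PropositionalEquality
  using (_≡_; _≢_; refl; sym; trans; cong; subst; isEquivalence)
open import Relation.Nullary using (¬_; Dec; yes; no; does; contradiction)
open import Relation.Nullary.Decidable using (dec-true; dec-false)
open import Relation.Unary using (Pred; Decidable)

-- Auxiliary facts on subsets, filtered lists and erasers.

x∈p─q⇒x∉q : ∀ {n} {x : Fin n} (p q : Subset n) → x ∈ p ─ q → x ∉ q
x∈p─q⇒x∉q (_ ∷ᵛ p) (outside ∷ᵛ q) (there x∈p─q) (there x∈q) = x∈p─q⇒x∉q p q x∈p─q x∈q
x∈p─q⇒x∉q (_ ∷ᵛ p) (inside  ∷ᵛ q) (there x∈p─q) (there x∈q) = x∈p─q⇒x∉q p q x∈p─q x∈q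

module _ {n} {A : Pred (Fin n) 0ℓ} (A? : Decidable A) where

  ⟦⟧ : Subset n
  ⟦⟧ = tabulate (does ∘ A?)

  ∈⟦⟧⁺ : ∀ {v} → A v → v ∈ ⟦⟧
  ∈⟦⟧⁺ {v} a = lookup⇒[]= v _ (trans (lookup∘tabulate _ v) (dec-true (A? v) a))

  ∈⟦⟧⁻ : ∀ {v} → v ∈ ⟦⟧ → A v
  ∈⟦⟧⁻ {v} v∈ with A? v | trans (sym (lookup∘tabulate (does ∘ A?) v)) ([]=⇒lookup v∈)
  ... | yes a | _ = a

module _ {X : Set} {A B : Pred X 0ℓ} (A? : Decidable A) (B? : Decidable B)
         (A⇒B : ∀ {x} → A x → B x) where

  length-filter-mono : ∀ xs → length (filter A? xs) ≤ length (filter B? xs)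
  length-filter-mono []       = z≤n
  length-filter-mono (x ∷ xs) with A? x | B? x
  ... | yes _ | yes _ = s≤s (length-filter-mono xs)
  ... | yes a | no ¬b = contradiction (A⇒B a) ¬b
  ... | no _  | yes _ = m≤n⇒m≤1+n (length-filter-mono xs)
  ... | no _  | no _  = length-filter-mono xs

  -- The witness is an entry that only the second filter retains. In the game it is a parent that
  -- has just been coloured.
  length-filter-mono-< : ∀ {xs} → Any (λ x → B x × ¬ A x) xs →
                         length (filter A? xs) < length (filter B? xs)
  length-filter-mono-< {x ∷ xs} (here (b , ¬a)) with A? x | B? x
  ... | yes a | _     = contradiction a ¬a
  ... | no _  | no ¬b = contradiction b ¬b
  ... | no _  | yes _ = s≤s (length-filter-mono xs)
  length-filter-mono-< {x ∷ xs} (there x∈xs) with A? x | B? x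
  ... | yes _ | yes _ = s≤s (length-filter-mono-< x∈xs)
  ... | yes a | no ¬b = contradiction (A⇒B a) ¬b
  ... | no _  | yes _ = m≤n⇒m≤1+n (length-filter-mono-< x∈xs)
  ... | no _  | no _  = length-filter-mono-< x∈xs

≤-useErasers : ∀ {n} (C : Subset n) (ℓ : Erasers n) {v m} →
               (v ∈ C → m ≤ pred (ℓ v)) → m ≤ ℓ v → m ≤ useErasers C ℓ v
≤-useErasers C ℓ {v} m≤pred m≤ℓ with v ∈? C
... | yes v∈C = m≤pred v∈C
... | no _    = m≤ℓ

-- The game on a graph with an acyclic orientation

module _ {n} (parents : Fin n → List (Fin n)) where

  Parent : Rel (Fin n) 0ℓ
  Parent u v = u ∈ˡ parents v

  module Response (P : Subset n) where

    -- The kept vertices form the kernel of the orientation restricted to `P`. `Dropped` is a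
    -- positive counterpart of the negation of `Kept`, which could not itself occur in an inductive
    -- definition of `Kept`.
    mutual
      data Kept (v : Fin n) : Set where
        kept : v ∈ P → All Dropped (parents v) → Kept v

      data Dropped (v : Fin n) : Set where
        unpresented : v ∉ P → Dropped v
        blocked     : Any Kept (parents v) → Dropped v

    mutual
      Kept⇒¬Dropped : ∀ {v} → Kept v → ¬ Dropped v
      Kept⇒¬Dropped (kept v∈P _)  (unpresented v∉P) = v∉P v∈P
      Kept⇒¬Dropped (kept _ ds)   (blocked ks)      = All-Dropped⇒¬Any-Kept ds ks

      All-Dropped⇒¬Any-Kept : ∀ {vs} → All Dropped vs → ¬ Any Kept vs
      All-Dropped⇒¬Any-Kept (d ∷ _)  (here k)   = Kept⇒¬Dropped k d
      All-Dropped⇒¬Any-Kept (_ ∷ ds) (there ks) = All-Dropped⇒¬Any-Kept ds ks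

    Kept⇒∈ : ∀ {v} → Kept v → v ∈ P
    Kept⇒∈ (kept v∈P _) = v∈P

    allDropped⊎anyKept : ∀ {vs} → All (λ v → Kept v ⊎ Dropped v) vs →
                         All Dropped vs ⊎ Any Kept vs
    allDropped⊎anyKept []            = inj₁ []
    allDropped⊎anyKept (inj₁ k ∷ _)  = inj₂ (here k)
    allDropped⊎anyKept (inj₂ d ∷ cs) with allDropped⊎anyKept cs
    ... | inj₁ ds = inj₁ (d ∷ ds)
    ... | inj₂ ks = inj₂ (there ks)

    -- Acyclicity enters here: the status of a presented vertex is settled once that of all its
    -- parents is.
    kept⊎dropped : ∀ v → Acc Parent v → Kept v ⊎ Dropped v
    kept⊎dropped v (acc rs) with v ∈? P
    ... | no v∉P  = inj₂ (unpresented v∉P)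
    ... | yes v∈P with allDropped⊎anyKept (All.tabulate λ {u} u∈ → kept⊎dropped u (rs u∈))
    ...   | inj₁ ds = inj₁ (kept v∈P ds)
    ...   | inj₂ ks = inj₂ (blocked ks)

  module _ (wf : WellFounded Parent) (G : Graph n)
           (oriented : ∀ {u v} → Adj G u v → SymClosure Parent u v) where

    uncolouredParents : Subset n → Fin n → ℕ
    uncolouredParents U v = length (filter (_∈? U) (parents v))

    module Round (P : Subset n) where
      open Response P

      kept? : Decidable Kept
      kept? v with kept⊎dropped v (wf v)
      ... | inj₁ k = yes k
      ... | inj₂ d = no λ k → Kept⇒¬Dropped k d

      C : Subset n
      C = P ─ ⟦⟧ kept?

      ∈C⇒blocked : ∀ {v} → v ∈ C → Any Kept (parents v)
      ∈C⇒blocked {v} v∈C with kept⊎dropped v (wf v)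
      ... | inj₁ k                 = contradiction (∈⟦⟧⁺ kept? k) (x∈p─q⇒x∉q P _ v∈C)
      ... | inj₂ (unpresented v∉P) = contradiction (p─q⊆p P _ v∈C) v∉P
      ... | inj₂ (blocked ks)      = ks

      ∈P─C⇒Kept : ∀ {v} → v ∈ P ─ C → Kept v
      ∈P─C⇒Kept {v} v∈ with kept? v
      ... | yes k = k
      ... | no ¬k = contradiction (x∈p∧x∉q⇒x∈p─q (p─q⊆p P C v∈) (¬k ∘ ∈⟦⟧⁻ kept?))
                                  (x∈p─q⇒x∉q P C v∈)

      Kept⇒∈P─C : ∀ {v} → Kept v → v ∈ P ─ C
      Kept⇒∈P─C k = x∈p∧x∉q⇒x∈p─q (Kept⇒∈ k) λ v∈C → x∈p─q⇒x∉q P _ v∈C (∈⟦⟧⁺ kept? k)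

      -- Every edge joins a vertex to one of its parents, and all parents of a kept vertex are
      -- dropped.
      independent : Independent G (P ─ C)
      independent u∈ v∈ uv = ¬linked (∈P─C⇒Kept u∈) (∈P─C⇒Kept v∈) (oriented uv)
        where
        ¬parent : ∀ {u v} → Kept u → Kept v → ¬ Parent u v
        ¬parent ku (kept _ ds) u∈ = Kept⇒¬Dropped ku (All.lookup ds u∈)
        ¬linked : ∀ {u v} → Kept u → Kept v → ¬ SymClosure Parent u v
        ¬linked ku kv (fwd u∈) = ¬parent ku kv u∈
        ¬linked ku kv (bwd v∈) = ¬parent kv ku v∈

      -- A presented vertex that is not kept has a kept parent. This makes the uncoloured set shrink
      -- in every round.
      nonempty : Nonempty P → Nonempty (P ─ C)
      nonempty (v , v∈P) with kept⊎dropped v (wf v)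
      ... | inj₁ k                 = v , Kept⇒∈P─C k
      ... | inj₂ (unpresented v∉P) = contradiction v∈P v∉P
      ... | inj₂ (blocked ks)      = proj₁ (Any.satisfied ks) , Kept⇒∈P─C (proj₂ (Any.satisfied ks))

    -- Invariant: every uncoloured vertex has an eraser for each uncoloured parent. `respond` also
    -- serves an empty `U`, where no nonempty `P` fits.
    wins : ∀ {U} → Acc _⊂_ U → (ℓ : Erasers n) →
           (∀ {v} → v ∈ U → uncolouredParents U v ≤ ℓ v) → CorrectWins G U ℓ
    wins {U} (acc rs) ℓ enough = respond λ P P≢∅ P⊆U →
      let open Round P
          open Response P using (Kept; Kept⇒∈)
          U′ = U ─ (P ─ C)

          U′⊆U : U′ ⊆ U
          U′⊆U = p─q⊆p U (P ─ C)

          k = proj₁ (nonempty P≢∅)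
          k∈ = proj₂ (nonempty P≢∅)

          C⊆U : C ⊆ U
          C⊆U v∈C = P⊆U (p─q⊆p P _ v∈C)

          -- The blocking parent lies in `U` because it is presented, and outside `U′` because it is
          -- now coloured for good.
          lost : ∀ {v} → v ∈ C → uncolouredParents U′ v < uncolouredParents U v
          lost v∈C = length-filter-mono-< (_∈? U′) (_∈? U) U′⊆U
            (Any.map (λ k → P⊆U (Kept⇒∈ k) , λ u∈U′ → x∈p─q⇒x∉q U (P ─ C) u∈U′ (Kept⇒∈P─C k))
                     (∈C⇒blocked v∈C))

          enough′ : ∀ {v} → v ∈ U′ → uncolouredParents U′ v ≤ useErasers C ℓ v
          enough′ {v} v∈U′ = ≤-useErasers C ℓ
            (λ v∈C → <⇒≤pred (≤-trans (lost v∈C) (enough (C⊆U v∈C))))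
            (≤-trans (length-filter-mono (_∈? U′) (_∈? U) U′⊆U (parents v)) (enough (U′⊆U v∈U′)))
      in C
       , p─q⊆p P _
       -- A strictly decreasing count was positive before the round, hence so was the number of
       -- erasers.
       , (λ v∈C → ≤-trans (≤-trans (s≤s z≤n) (lost v∈C)) (enough (C⊆U v∈C)))
       , independent
       , wins (rs (U′⊆U , k , P⊆U (p─q⊆p P C k∈) , λ k∈U′ → x∈p─q⇒x∉q U (P ─ C) k∈U′ k∈))
              (useErasers C ℓ) enough′

    paintable : (ℓ : Erasers n) → (∀ v → length (parents v) ≤ ℓ v) → Paintable G ℓ
    paintable ℓ enough = wins (⊂-wellFounded ⊤) ℓ λ {v} _ →
      ≤-trans (length-filter (_∈? ⊤) (parents v)) (enough v)

-- Construction orders of series-parallel graphs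

-- The terminals have rank 0, hence no parents; this makes the notion symmetric
-- in s and t, whether or not they are adjacent.
record ConstructionOrder {n} (G : Graph n) (s t : Fin n) : Set where
  field
    parents        : Fin n → List (Fin n)
    rank           : Fin n → ℕ
    rank-parent    : ∀ {u v} → u ∈ˡ parents v → rank u < rank v
    length-parents : ∀ v → length (parents v) ≤ 2
    s≢t            : s ≢ t
    rank-s         : rank s ≡ 0
    rank-t         : rank t ≡ 0
    oriented       : ∀ {u v} → Adj G u v →
                     SymClosure (λ u v → (u ≡ s × v ≡ t) ⊎ u ∈ˡ parents v) u v

  rank-0⇒∉parents : ∀ {u v} → rank v ≡ 0 → u ∉ˡ parents v
  rank-0⇒∉parents {u} rank-v u∈ = n≮0 (subst (rank u <_) rank-v (rank-parent u∈))

  rank-0⇒parents-[] : ∀ {v} → rank v ≡ 0 → parents v ≡ []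
  rank-0⇒parents-[] {v} rank-v = empty (parents v) (rank-0⇒∉parents rank-v)
    where
    empty : ∀ us → (∀ {u} → u ∉ˡ us) → us ≡ []
    empty []      _ = refl
    empty (_ ∷ _) ∉ = contradiction (here refl) ∉

-- Only the pair of terminals, which `oriented` exempts from the parent relation, changes direction.
reverse : ∀ {n} {G : Graph n} {s t} → ConstructionOrder G s t → ConstructionOrder G t s
reverse {s = s} {t} O = record
  { parents        = parents
  ; rank           = rank
  ; rank-parent    = rank-parent
  ; length-parents = length-parents
  ; s≢t            = s≢t ∘ sym
  ; rank-s         = rank-t
  ; rank-t         = rank-s
  ; oriented       = flip ∘ oriented
  }
  where
  open ConstructionOrder O
  flip : ∀ {u v} → SymClosure (λ u v → (u ≡ s × v ≡ t) ⊎ u ∈ˡ parents v) u v →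
         SymClosure (λ u v → (u ≡ t × v ≡ s) ⊎ u ∈ˡ parents v) u v
  flip (fwd (inj₁ (p , q))) = bwd (inj₁ (q , p))
  flip (fwd (inj₂ u∈))      = fwd (inj₂ u∈)
  flip (bwd (inj₁ (p , q))) = fwd (inj₁ (q , p))
  flip (bwd (inj₂ v∈))      = bwd (inj₂ v∈)

-- An order in which the terminal t becomes an ordinary vertex, coming right
-- after s, with a prescribed list of parents; e embeds the vertices.
module Extend {n} {G : Graph n} {s t} (O : ConstructionOrder G s t)
              {B : Set} (e : Fin n → B) (ts : List B) where
  open ConstructionOrder O

  parents⁺ : Fin n → List B
  parents⁺ v = if does (v ≟ t) then ts else map e (parents v)

  -- Everything but `s` moves up by one, so `t` gets rank 1: above prescribed parents of rank 0, and
  -- below its children, whose old ranks were positive.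
  rank⁺ : Fin n → ℕ
  rank⁺ v = if does (v ≟ s) then 0 else suc (rank v)

  parents⁺-t : parents⁺ t ≡ ts
  parents⁺-t rewrite dec-true (t ≟ t) refl = refl

  parents⁺-≢t : ∀ {v} → v ≢ t → parents⁺ v ≡ map e (parents v)
  parents⁺-≢t {v} v≢t rewrite dec-false (v ≟ t) v≢t = refl

  parents⁺-s : parents⁺ s ≡ []
  parents⁺-s rewrite parents⁺-≢t s≢t | rank-0⇒parents-[] rank-s = refl

  rank⁺-s : rank⁺ s ≡ 0
  rank⁺-s rewrite dec-true (s ≟ s) refl = refl

  rank⁺-t : rank⁺ t ≡ 1
  rank⁺-t rewrite dec-false (t ≟ s) (s≢t ∘ sym) = cong suc rank-t

  rank⁺-≤ : ∀ v → rank⁺ v ≤ suc (rank v)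
  rank⁺-≤ v with v ≟ s
  ... | yes _ = z≤n
  ... | no _  = ≤-refl

  -- `ρ` ranks the whole target of `e`. The prescribed parents may lie outside the image of `e`, so
  -- their rank is a separate hypothesis.
  rank⁺-parent : (ρ : B → ℕ) → (∀ v → ρ (e v) ≡ rank⁺ v) → (∀ {b} → b ∈ˡ ts → ρ b ≡ 0) →
                 ∀ {b} v → b ∈ˡ parents⁺ v → ρ b < rank⁺ v
  rank⁺-parent ρ ρ∘e ρ-ts {b} v b∈ with v ≟ t
  ... | yes refl rewrite rank⁺-t | ρ-ts b∈ = s≤s z≤n
  ... | no _ with u , u∈ , refl ← ∈-map⁻ e b∈ with v ≟ s
  ...   | yes refl = contradiction u∈ (rank-0⇒∉parents rank-s)
  ...   | no _ rewrite ρ∘e u = s≤s (≤-trans (rank⁺-≤ u) (rank-parent u∈))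

  length-parents⁺ : length ts ≤ 2 → ∀ v → length (parents⁺ v) ≤ 2
  length-parents⁺ ts≤2 v with v ≟ t
  ... | yes _ = ts≤2
  ... | no _ rewrite length-map e (parents v) = length-parents v

  -- An edge between the terminals, exempt so far, becomes an ordinary one because `s` is among the
  -- new parents of `t`.
  oriented⁺ : e s ∈ˡ ts → ∀ {u v} → Adj G u v → SymClosure (λ u v → e u ∈ˡ parents⁺ v) u v
  oriented⁺ s∈ts = Sym.map link ∘ oriented
    where
    link : ∀ {u v} → (u ≡ s × v ≡ t) ⊎ u ∈ˡ parents v → e u ∈ˡ parents⁺ v
    link (inj₁ (refl , refl)) = subst (e s ∈ˡ_) (sym parents⁺-t) s∈ts
    link {v = v} (inj₂ u∈) with v ≟ t
    ... | yes refl = contradiction u∈ (rank-0⇒∉parents rank-t)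
    ... | no _     = ∈-map⁺ e u∈

-- Orders on glued graphs, for series and parallel composition.

module Glue {n₁ n₂ n} {G₁ : Graph n₁} {G₂ : Graph n₂} {_~_ : Rel (Fin n₁ ⊎ Fin n₂) 0ℓ}
            {G : Graph n} {q} (glue : IsGluing G₁ G₂ _~_ G q) where
  open IsGluing glue

  -- The fibres of `q` are the classes of the equivalence generated by `_~_`, so the generators
  -- suffice. With a Boolean `f` this also separates vertices of the glued graph.
  invariant : ∀ {A : Set} (f : Fin n₁ ⊎ Fin n₂ → A) → (∀ {x y} → x ~ y → f x ≡ f y) →
              ∀ {x y} → q x ≡ q y → f x ≡ f y
  invariant f f-resp qx≡qy = Eq.gfold isEquivalence f f-resp (Equivalence.to kernel qx≡qy)

  preimage : Fin n → Fin n₁ ⊎ Fin n₂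
  preimage v = proj₁ (surjective v)

  q-preimage : ∀ v → q (preimage v) ≡ v
  q-preimage v = proj₂ (surjective v) refl

  module _ (s t : Fin n₁ ⊎ Fin n₂)
           (parents : Fin n₁ ⊎ Fin n₂ → List (Fin n₁ ⊎ Fin n₂))
           (rank : Fin n₁ ⊎ Fin n₂ → ℕ)
           (parents-resp : ∀ {x y} → x ~ y → map q (parents x) ≡ map q (parents y))
           (rank-resp : ∀ {x y} → x ~ y → rank x ≡ rank y)
           (rank-parent : ∀ {x} y → x ∈ˡ parents y → rank x < rank y)
           (length-parents : ∀ x → length (parents x) ≤ 2)
           (s≢t : q s ≢ q t) (rank-s : rank s ≡ 0) (rank-t : rank t ≡ 0)
           (oriented : ∀ {x y} → Pointwise (Adj G₁) (Adj G₂) x y →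
             SymClosure (λ x y → (q x ≡ q s × q y ≡ q t) ⊎ x ∈ˡ parents y) x y) where

    rank-preimage : ∀ x → rank (preimage (q x)) ≡ rank x
    rank-preimage x = invariant rank rank-resp (q-preimage (q x))

    parents-preimage : ∀ x → map q (parents (preimage (q x))) ≡ map q (parents x)
    parents-preimage x = invariant (map q ∘ parents) parents-resp (q-preimage (q x))

    -- Ranks and parents are read off at a chosen representative; `rank-resp` and `parents-resp`
    -- make the choice immaterial.
    order : ConstructionOrder G (q s) (q t)
    order = record
      { parents        = map q ∘ parents ∘ preimage
      ; rank           = rank ∘ preimage
      ; rank-parent    = rank-parent′
      ; length-parents = λ v → subst (_≤ 2) (sym (length-map q (parents (preimage v))))
                                     (length-parents (preimage v))
      ; s≢t            = s≢t
      ; rank-s         = trans (rank-preimage s) rank-s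
      ; rank-t         = trans (rank-preimage t) rank-t
      ; oriented       = oriented′ ∘ Equivalence.to adjacency
      }
      where
      rank-parent′ : ∀ {u v} → u ∈ˡ map q (parents (preimage v)) → rank (preimage u) < rank (preimage v)
      rank-parent′ {v = v} u∈ with x , x∈ , refl ← ∈-map⁻ q u∈ =
        ≤-<-trans (≤-reflexive (rank-preimage x)) (rank-parent (preimage v) x∈)

      link : ∀ {x y} → (q x ≡ q s × q y ≡ q t) ⊎ x ∈ˡ parents y →
             (q x ≡ q s × q y ≡ q t) ⊎ q x ∈ˡ map q (parents (preimage (q y)))
      link (inj₁ st)         = inj₁ st
      link {y = y} (inj₂ x∈) = inj₂ (subst (_ ∈ˡ_) (sym (parents-preimage y)) (∈-map⁺ q x∈))

      oriented′ : ∀ {u v} → ∃[ x ] ∃[ y ] (q x ≡ u × q y ≡ v × Pointwise (Adj G₁) (Adj G₂) x y) →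
                  SymClosure (λ u v → (u ≡ q s × v ≡ q t) ⊎ u ∈ˡ map q (parents (preimage v))) u v
      oriented′ (x , y , refl , refl , xy) = Sym.gmap q link (oriented xy)

module Series {n₁ n₂ n} {G₁ : Graph n₁} {G₂ : Graph n₂} {G : Graph n} {s₁ t₁ s₂ t₂ q}
              (O₁ : ConstructionOrder G₁ s₁ t₁) (O₂ : ConstructionOrder G₂ s₂ t₂)
              (glue : IsGluing G₁ G₂ (SeriesId t₁ s₂) G q) where

  terminals : List (Fin n₁ ⊎ Fin n₂)
  terminals = inj₁ s₁ ∷ inj₂ t₂ ∷ []

  module E₁ = Extend O₁ inj₁ terminals
  -- The second part is reversed: its sink, a terminal of the whole, stays at rank 0, and its source
  -- becomes the middle vertex, with the same rank and parents as in the first part.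
  module E₂ = Extend (reverse O₂) inj₂ terminals

  rank : Fin n₁ ⊎ Fin n₂ → ℕ
  rank = [ E₁.rank⁺ , E₂.rank⁺ ]

  parents : Fin n₁ ⊎ Fin n₂ → List (Fin n₁ ⊎ Fin n₂)
  parents = [ E₁.parents⁺ , E₂.parents⁺ ]

  rank-terminals : ∀ {x} → x ∈ˡ terminals → rank x ≡ 0
  rank-terminals (here refl)         = E₁.rank⁺-s
  rank-terminals (there (here refl)) = E₂.rank⁺-s

  order : ConstructionOrder G (q (inj₁ s₁)) (q (inj₂ t₂))
  order = Glue.order glue (inj₁ s₁) (inj₂ t₂) parents rank
    (λ { t₁~s₂ → cong (map q) (trans E₁.parents⁺-t (sym E₂.parents⁺-t)) })
    (λ { t₁~s₂ → trans E₁.rank⁺-t (sym E₂.rank⁺-t) })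
    (λ { (inj₁ v) → E₁.rank⁺-parent rank (λ _ → refl) rank-terminals v
       ; (inj₂ v) → E₂.rank⁺-parent rank (λ _ → refl) rank-terminals v })
    [ E₁.length-parents⁺ ≤-refl , E₂.length-parents⁺ ≤-refl ]
    s≢t E₁.rank⁺-s E₂.rank⁺-s
    λ { (inj₁ uv) → Sym.gmap inj₁ inj₂ (E₁.oriented⁺ (here refl) uv)
      ; (inj₂ uv) → Sym.gmap inj₂ inj₂ (E₂.oriented⁺ (there (here refl)) uv) }
    where
    s≢t : q (inj₁ s₁) ≢ q (inj₂ t₂)
    -- The test for being `s₁` respects the gluing, as `t₁` differs from `s₁`, and it fails
    -- throughout the second part.
    s≢t eq with trans (sym (dec-true (s₁ ≟ s₁) refl))
                      (Glue.invariant glue [ (λ v → does (v ≟ s₁)) , const false ]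
                        (λ { t₁~s₂ → dec-false (t₁ ≟ s₁) (ConstructionOrder.s≢t O₁ ∘ sym) }) eq)
    ... | ()

module Parallel {n₁ n₂ n} {G₁ : Graph n₁} {G₂ : Graph n₂} {G : Graph n} {s₁ t₁ s₂ t₂ q}
                (O₁ : ConstructionOrder G₁ s₁ t₁) (O₂ : ConstructionOrder G₂ s₂ t₂)
                (glue : IsGluing G₁ G₂ (ParallelId s₁ t₁ s₂ t₂) G q) where

  module O₁ = ConstructionOrder O₁
  module O₂ = ConstructionOrder O₂

  parents : Fin n₁ ⊎ Fin n₂ → List (Fin n₁ ⊎ Fin n₂)
  parents = [ map inj₁ ∘ O₁.parents , map inj₂ ∘ O₂.parents ]

  rank : Fin n₁ ⊎ Fin n₂ → ℕ
  rank = [ O₁.rank , O₂.rank ]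

  parents-0 : ∀ {u v} → O₁.rank u ≡ 0 → O₂.rank v ≡ 0 →
              map q (parents (inj₁ u)) ≡ map q (parents (inj₂ v))
  parents-0 u0 v0 rewrite O₁.rank-0⇒parents-[] u0 | O₂.rank-0⇒parents-[] v0 = refl

  rank-parent : ∀ {x} y → x ∈ˡ parents y → rank x < rank y
  rank-parent (inj₁ _) x∈ with _ , u∈ , refl ← ∈-map⁻ inj₁ x∈ = O₁.rank-parent u∈
  rank-parent (inj₂ _) x∈ with _ , u∈ , refl ← ∈-map⁻ inj₂ x∈ = O₂.rank-parent u∈

  length-parents : ∀ x → length (parents x) ≤ 2
  length-parents (inj₁ v) = subst (_≤ 2) (sym (length-map inj₁ (O₁.parents v))) (O₁.length-parents v)
  length-parents (inj₂ v) = subst (_≤ 2) (sym (length-map inj₂ (O₂.parents v))) (O₂.length-parents v)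

  qs₂≡qs₁ : q (inj₂ s₂) ≡ q (inj₁ s₁)
  qs₂≡qs₁ = sym (Equivalence.from (IsGluing.kernel glue) (Eq.return s₁~s₂))

  qt₂≡qt₁ : q (inj₂ t₂) ≡ q (inj₁ t₁)
  qt₂≡qt₁ = sym (Equivalence.from (IsGluing.kernel glue) (Eq.return t₁~t₂))

  oriented : ∀ {x y} → Pointwise (Adj G₁) (Adj G₂) x y →
             SymClosure (λ x y → (q x ≡ q (inj₁ s₁) × q y ≡ q (inj₁ t₁)) ⊎ x ∈ˡ parents y) x y
  oriented (inj₁ uv) = Sym.gmap inj₁
    (λ { (inj₁ (refl , refl)) → inj₁ (refl , refl) ; (inj₂ u∈) → inj₂ (∈-map⁺ inj₁ u∈) })
    (O₁.oriented uv)
  oriented (inj₂ uv) = Sym.gmap inj₂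
    -- The terminal pair of the second part is merged with that of the first, so an edge there
    -- remains exempt.
    (λ { (inj₁ (refl , refl)) → inj₁ (qs₂≡qs₁ , qt₂≡qt₁) ; (inj₂ u∈) → inj₂ (∈-map⁺ inj₂ u∈) })
    (O₂.oriented uv)

  -- The identified vertices are terminals, of rank 0 and without parents on either side, so the two
  -- orders fit together unchanged.
  order : ConstructionOrder G (q (inj₁ s₁)) (q (inj₁ t₁))
  order = Glue.order glue (inj₁ s₁) (inj₁ t₁) parents rank
    (λ { s₁~s₂ → parents-0 O₁.rank-s O₂.rank-s ; t₁~t₂ → parents-0 O₁.rank-t O₂.rank-t })
    (λ { s₁~s₂ → trans O₁.rank-s (sym O₂.rank-s) ; t₁~t₂ → trans O₁.rank-t (sym O₂.rank-t) })
    rank-parent length-parents s≢t O₁.rank-s O₁.rank-t oriented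
    where
    s≢t : q (inj₁ s₁) ≢ q (inj₁ t₁)
    -- The test for being a source agrees on identified vertices and tells the two terminals apart.
    s≢t eq with trans (sym (dec-true (s₁ ≟ s₁) refl))
                      (trans (Glue.invariant glue [ (λ v → does (v ≟ s₁)) , (λ v → does (v ≟ s₂)) ]
                        (λ { s₁~s₂ → trans (dec-true (s₁ ≟ s₁) refl) (sym (dec-true (s₂ ≟ s₂) refl))
                           ; t₁~t₂ → trans (dec-false (t₁ ≟ s₁) (O₁.s≢t ∘ sym))
                                           (sym (dec-false (t₂ ≟ s₂) (O₂.s≢t ∘ sym))) }) eq)
                        (dec-false (t₁ ≟ s₁) (O₁.s≢t ∘ sym)))
    ... | ()

-- Induction over the compositions, and the final order for the game.

constructionOrder : ∀ {n} {G : Graph n} {s t} → SeriesParallel G s t → ConstructionOrder G s t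
-- All vertices are terminals and the only edge is exempt, so no parents are needed.
constructionOrder {G = G} {s} {t} (edge st only) = record
  { parents        = λ _ → []
  ; rank           = λ _ → 0
  ; rank-parent    = λ ()
  ; length-parents = λ _ → z≤n
  ; s≢t            = λ s≡t → irrefl s≡t st
  ; rank-s         = refl
  ; rank-t         = refl
  ; oriented       = λ {u} {v} uv → orient uv (only u) (only v)
  }
  where
  open Graph G using (irrefl)
  orient : ∀ {u v} → Adj G u v → u ≡ s ⊎ u ≡ t → v ≡ s ⊎ v ≡ t →
           SymClosure (λ u v → (u ≡ s × v ≡ t) ⊎ u ∈ˡ []) u v
  orient uv (inj₁ p)    (inj₁ refl) = contradiction uv (irrefl p)
  orient uv (inj₁ p)    (inj₂ q)    = fwd (inj₁ (p , q))
  orient uv (inj₂ p)    (inj₁ q)    = bwd (inj₁ (q , p))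
  orient uv (inj₂ p)    (inj₂ refl) = contradiction uv (irrefl p)
constructionOrder (series sp₁ sp₂ glue) =
  Series.order (constructionOrder sp₁) (constructionOrder sp₂) glue
constructionOrder (parallel sp₁ sp₂ glue) =
  Parallel.order (constructionOrder sp₁) (constructionOrder sp₂) glue

theorem5 : ∀ {n : ℕ} (G : Graph n) (s t : Fin n) → SeriesParallel G s t →
    (ℓ : Erasers n) → ℓ s ≡ 0 → ℓ t ≡ 1 →
    (∀ v → v ≢ s → v ≢ t → ℓ v ≡ 2) →
    Paintable G ℓ
theorem5 G s t sp ℓ ℓs ℓt ℓv = paintable parents⁺ wf G (oriented⁺ (here refl)) ℓ enough
  where
  -- The single parent `s` for `t` orients the edge left exempt. Now `s` has no parent, `t` has one
  -- and the others have at most two, matching 0, 1 and 2 erasers.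
  open Extend (constructionOrder sp) id (s ∷ [])

  wf : WellFounded (Parent parents⁺)
  wf = Subrelation.wellFounded
    (λ {_} {v} → rank⁺-parent rank⁺ (λ _ → refl) (λ { (here refl) → rank⁺-s }) v)
    (On.wellFounded rank⁺ <-wellFounded)

  enough : ∀ v → length (parents⁺ v) ≤ ℓ v
  enough v = bound (v ≟ s) (v ≟ t)
    where
    bound : ∀ {v} → Dec (v ≡ s) → Dec (v ≡ t) → length (parents⁺ v) ≤ ℓ v
    bound (yes refl) _          rewrite parents⁺-s = z≤n
    bound (no _)     (yes refl) rewrite parents⁺-t | ℓt = ≤-refl
    bound {v} (no v≢s) (no v≢t) rewrite ℓv v v≢s v≢t = length-parents⁺ (s≤s z≤n) v
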